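{- Let $O\rhd c_1$ and $O\rhd c_2$ be P-markings. Then $O\rhd c_1\sim_{C}O\rhd c_2$ if and only if $[O]_\cong\rhd c_1\alpha_O\sim_{AC}[O]_\cong\rhd c_2\alpha_O$.
   Context: Fix a set $Act$ of action labels and an infinite set $\mathcal{E}$ of event names. A finite $Act$-labelled poset (poset for short) is $O=(X_O,\preccurlyeq_O,l_O)$ with $X_O\subseteq\mathcal{E}$ finite, $\preccurlyeq_O$ a partial order on $X_O$, $l_O\colon X_O\to Act$; $|O|=\{(x,l_O(x)):x\in X_O\}$, $x_a$ denotes $(x,a)$, and $O$ is also regarded as a poset on $|O|$. A morphism is an order- and label-preserving map, acting on labelled events by $\sigma(x_a)=\sigma(x)_a$; an isomorphism is a bijective morphism with morphism inverse. For $K\subseteq|O|$, $\max_O K$ is its set of maximal elements; $K$ is down-closed if $y\in K$, $x\preccurlyeq_O y$ imply $x\in K$. A net $N=(S,T,F,l)$: disjoint sets $S,T$, $F\subseteq(S\times T)\cup(T\times S)$, $l\colon T\to Act$, ${}^\bullet t=\{s:(s,t)\in F\}$, $t^\bullet=\{s:(t,s)\in F\}$ nonempty. Fix $N$. A causal marking is a finite set $c$ of pairs $K\vdash s$ ($s\in S$, $K$ finite $\subseteq\mathcal{E}\times Act$); $\mathcal{K}(c)$ is the union of its cause sets, $|c|$ its set of places, $K\vdash m=\{K\vdash s:s\in m\}$, and $c\sigma=\{\sigma(K)\vdash s:K\vdash s\in c\}$. A P-marking $O\rhd c$: every cause set of $c$ is a down-closed subset of $|O|$. $\delta(O,K,e_a)$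 (for $K\subseteq|O|$, $e\notin X_O$) is $O$ plus the event $e$ with label $a$ above every element of $K$, reflexively-transitively closed. Concrete causal case graph (CG$_C$): smallest transition relation on P-markings with $O\rhd c\cup c'\xrightarrow{K\vdash e_a}\delta(O,K,e_a)\rhd(\mathcal{K}(c)\cup\{e_a\}\vdash t^\bullet)\cup c'$ whenever $t\in T$, $O\rhd c\cup c'$ is a P-marking, $|c|={}^\bullet t$, $a=l(t)$, $e\in\mathcal{E}\setminus X_O$, $K=\max_O\mathcal{K}(c)$. A concrete causal bisimulation is a family $\{R_O\}$ of relations on P-markings indexed by posets such that: if $(O_1\rhd c_1,O_2\rhd c_2)\in R_O$ then $O_1=O_2=O$; and if $(O\rhd c_1,O\rhd c_2)\in R_O$ and $O\rhd c_1\xrightarrow{K\vdash e_a}O'\rhd c_1'$ then $O\rhd c_2\xrightarrow{K\vdash e_a}O'\rhd c_2'$ for some $c_2'$ with $(O'\rhd c_1',O'\rhd c_2')\in R_{O'}$, and vice versa. $\sim_C$ is the greatest one. Abstract setting: for each poset $O$ fix a canonical representative $[O]_\cong$ of its isomorphism class and an isomorphism $\alpha_O\colon O\to[O]_\cong$; $O$ is abstract if $[O]_\cong=O$, and an abstract P-marking is one whose poset is abstract. For abstract $O$, $K\subseteq|O|$, $a\in Act$: $\delta(O,K,a)=[\delta(O,K,e_a)]_\cong$ (any $e\notin X_O$), $new(O,K,a)$ is the element of $\delta(O,K,a)$ corresponding to the added event and $old(O,K,a)\colon O\to\delta(O,K,a)$ the embedding corresponding to the inclusion of $O$ (fixed choices).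 For a CG$_C$ transition $O\rhd c\xrightarrow{K\vdash e_a}\delta(O,K,e_a)\rhd c'$, let $c'_{O,K,e_a}$ be $c'$ renamed by the isomorphism $\delta(O,K,e_a)\to\delta([O]_\cong,\alpha_O(K),a)$ sending $x\in X_O$ to $old([O]_\cong,\alpha_O(K),a)(\alpha_O(x))$ and $e_a$ to $new([O]_\cong,\alpha_O(K),a)$. The abstract causal case graph (CG$_{AC}$) has a transition $[O]_\cong\rhd c\alpha_O\stackrel{\alpha_O(K)\vdash a}{\Longrightarrow}\delta([O]_\cong,\alpha_O(K),a)\rhd c'_{O,K,e_a}$ for each such CG$_C$ transition. An abstract causal bisimulation is a family $\{R_O\}$ indexed by abstract posets of relations on abstract P-markings such that: $(O_1\rhd c_1,O_2\rhd c_2)\in R_O$ implies $O_1=O_2=O$; and if $(O\rhd c_1,O\rhd c_2)\in R_O$ and $O\rhd c_1\stackrel{K\vdash a}{\Longrightarrow}O'\rhd c_1'$ then $O\rhd c_2\stackrel{K\vdash a}{\Longrightarrow}O'\rhd c_2'$ with $(O'\rhd c_1',O'\rhd c_2')\in R_{O'}$, and vice versa. $\sim_{AC}$ is the greatest one. -}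

module Defs where

open import Data.Empty using (⊥-elim)
open import Data.List.Base using (List; []; _∷_; _++_; map; concatMap)
open import Data.List.Membership.Propositional using (_∈_; _∉_)
open import Data.List.Relation.Unary.All as All using (All; []; _∷_)
open import Data.List.Relation.Unary.Any using (here; there)
import Data.List.Relation.Binary.Subset.Setoid as Subset
open import Data.Product.Base using (Σ; Σ-syntax; ∃; ∃-syntax; _×_; _,_; proj₁; proj₂; swap)
open import Data.Product.Relation.Binary.Pointwise.NonDependent using (_×ₛ_)
open import Data.Sum.Base using (_⊎_; inj₁; inj₂)
open import Function.Base using (_on_; _∘_; id)
open import Function.Bundles using (_⇔_)
open import Function.Definitions using (Inverseᵇ)
open import Level using (Level; 0ℓ; suc)
open import Relation.Binary.Bundles using (Setoid)
open import Relation.Binary.Construct.Closure.ReflexiveTransitive using (Star; ε; _◅_; _◅◅_)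
open import Relation.Binary.Core using (Rel)
open import Relation.Binary.Morphism.Structures using (IsOrderHomomorphism)
open import Relation.Binary.PropositionalEquality
  using (_≡_; refl; sym; trans; cong; cong₂; subst; setoid; isEquivalence)
import Relation.Binary.Construct.On as On
open import Relation.Binary.Structures using (IsPartialOrder)
open import Relation.Unary using (Pred; _≐_; Satisfiable)

-- Finite subsets are lists up to mutual inclusion.

FinSet : Setoid 0ℓ 0ℓ → Setoid 0ℓ 0ℓ
FinSet A = record
  { Carrier       = List (Setoid.Carrier A)
  ; _≈_           = λ xs ys → xs ⊆ ys × ys ⊆ xs
  ; isEquivalence = record
    { refl  = id , id
    ; sym   = swap
    ; trans = λ (p , q) (p′ , q′) → p′ ∘ p , q ∘ q′
    }
  }
  where open Subset A using (_⊆_)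

-- Constructively stronger than ¬ finite, classically the same.

Infinite : Set → Set
Infinite A = (xs : List A) → ∃[ x ] x ∉ xs

-- Disjointness of places and transitions is built into the sum types.

record Net (Act : Set) : Set₁ where
  field
    S T : Set
    F   : Pred ((S × T) ⊎ (T × S)) 0ℓ
    l   : T → Act

  •_ : T → Pred S 0ℓ
  (• t) s = F (inj₁ (s , t))

  _• : T → Pred S 0ℓ
  (t •) s = F (inj₂ (t , s))

  field
    post-nonempty : ∀ t → Satisfiable (t •)

module Posets (Act ℰ : Set) where

  LEvent : Set
  LEvent = ℰ × Act

  CauseSet : Set
  CauseSet = List LEvent

  open Setoid (FinSet (setoid ℰ)) public using () renaming (_≈_ to _≈ˣ_)
  open Setoid (FinSet (setoid LEvent)) public using () renaming (_≈_ to _≈ᵏ_)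

  -- An element of X is a name with a proof of membership in the list X.
  -- Such proofs need not be unique, so elements are compared by name.

  Elem : List ℰ → Set
  Elem X = ∃[ x ] x ∈ X

  name : ∀ {X} → Elem X → ℰ
  name = proj₁

  infix 4 _≈_

  _≈_ : ∀ {X} → Rel (Elem X) 0ℓ
  _≈_ = _≡_ on name

  record LPoset : Set₁ where
    infix 4 _≼_
    field
      X              : List ℰ
      _≼_            : Rel (Elem X) 0ℓ
      isPartialOrder : IsPartialOrder _≈_ _≼_
      l              : Elem X → Act
      l-cong         : ∀ {x y} → x ≈ y → l x ≡ l y

    labelled : Elem X → LEvent
    labelled x = name x , l x

  open LPoset public using (X)

  Event : LPoset → Set
  Event O = Elem (X O)

  ∣_∣ : LPoset → Pred LEvent 0ℓ
  ∣ O ∣ z = Σ[ x ∈ Event O ] LPoset.labelled O x ≡ z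

  -- Equality of posets on the nose, not up to isomorphism.

  infix 4 _≈ₚ_

  record _≈ₚ_ (O O′ : LPoset) : Set where
    private
      module O  = LPoset O
      module O′ = LPoset O′
    field
      events : X O ≈ˣ X O′
      order  : ∀ {x y : Event O} {x′ y′ : Event O′} →
               name x ≡ name x′ → name y ≡ name y′ → (x O.≼ y) ⇔ (x′ O′.≼ y′)
      labels : ∀ {x : Event O} {x′ : Event O′} →
               name x ≡ name x′ → O.l x ≡ O′.l x′

  record IsMorphism (O O′ : LPoset) (σ : Event O → Event O′) : Set where
    private
      module O  = LPoset O
      module O′ = LPoset O′
    field
      isOrderHomomorphism : IsOrderHomomorphism _≈_ _≈_ O._≼_ O′._≼_ σ
      label-preserving    : ∀ x → O′.l (σ x) ≡ O.l x

    open IsOrderHomomorphism isOrderHomomorphism public using (mono) renaming (cong to ≈-cong)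

  record IsIsomorphism (O O′ : LPoset) (σ : Event O → Event O′) : Set where
    field
      isMorphism         : IsMorphism O O′ σ
      inverse            : Event O′ → Event O
      inverse-isMorphism : IsMorphism O′ O inverse
      inverseᵇ           : Inverseᵇ _≈_ _≈_ σ inverse

  infix 4 _≅_

  _≅_ : LPoset → LPoset → Set
  O ≅ O′ = ∃ (IsIsomorphism O O′)

  -- σ(K) for K ⊆ |O|, where σ(xₐ) = σ(x)ₐ.

  image : ∀ {O Y} → (Event O → Elem Y) → ∀ {K} → All ∣ O ∣ K → CauseSet
  image σ = All.reduce (λ { {_ , a} (x , _) → name (σ x) , a })

  image⁺ : ∀ {O O′} (σ : Event O → Event O′) → IsMorphism O O′ σ →
           ∀ {K} (K⊆ : All ∣ O ∣ K) (x : Event O) →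
           LPoset.labelled O x ∈ K → LPoset.labelled O′ (σ x) ∈ image {O} σ K⊆
  image⁺ σ m ((x′ , refl) ∷ _) x (here eq) =
    here (cong₂ _,_ (IsMorphism.≈-cong m {x} {x′} (cong proj₁ eq))
                    (trans (IsMorphism.label-preserving m x) (cong proj₂ eq)))
  image⁺ σ m (_ ∷ K⊆) x (there i) = there (image⁺ σ m K⊆ x i)

  image⁻ : ∀ {O Y} (σ : Event O → Elem Y) {K} (K⊆ : All ∣ O ∣ K) {y} →
           y ∈ image {O} σ K⊆ →
           Σ[ x ∈ Event O ] LPoset.labelled O x ∈ K × y ≡ (name (σ x) , LPoset.l O x)
  image⁻ σ ((x , refl) ∷ _) (here eq) = x , here refl , eq
  image⁻ {O} σ (_ ∷ K⊆) (there i) with image⁻ {O} σ K⊆ i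
  ... | x , x∈K , eq = x , there x∈K , eq

  image⊆ : ∀ {O O′} (σ : Event O → Event O′) → IsMorphism O O′ σ →
           ∀ {K} (K⊆ : All ∣ O ∣ K) → All ∣ O′ ∣ (image {O} σ K⊆)
  image⊆ σ m []                = []
  image⊆ σ m ((x , refl) ∷ K⊆) =
    (σ x , cong (name (σ x) ,_) (IsMorphism.label-preserving m x)) ∷ image⊆ σ m K⊆

  maximal : (O : LPoset) → CauseSet → Pred LEvent 0ℓ
  maximal O K z = z ∈ K ×
    (Σ[ x ∈ Event O ] labelled x ≡ z × (∀ y → labelled y ∈ K → x ≼ y → x ≈ y))
    where open LPoset O

  maximal⊆ : ∀ O {K M} → (_∈ K) ≐ maximal O M → All ∣ O ∣ K
  maximal⊆ O (K⊆max , _) = All.tabulate λ z∈K →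
    let _ , x , eq , _ = K⊆max z∈K in x , eq

  record DownClosed (O : LPoset) (K : CauseSet) : Set where
    open LPoset O
    field
      within : All ∣ O ∣ K
      closed : ∀ {x y} → labelled y ∈ K → x ≼ y → labelled x ∈ K

  -- The order of δ(O,K,eₐ) is the reflexive-transitive closure of _⊏_.

  module Extension (O : LPoset) (K : CauseSet) (e : ℰ) where
    private module O = LPoset O

    infix 4 _⊏_

    data _⊏_ : Rel (Elem (e ∷ X O)) 0ℓ where
      old : ∀ {x p y q} → (x , p) O.≼ (y , q) → (x , there p) ⊏ (y , there q)
      new : ∀ {x p} → O.labelled (x , p) ∈ K → (x , there p) ⊏ (e , here refl)

    ⊏*-old : ∀ {x p y q} → Star _⊏_ (x , there p) (y , there q) → (x , p) O.≼ (y , q)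
    ⊏*-old ε               = IsPartialOrder.refl O.isPartialOrder
    ⊏*-old (old r ◅ rs)    = IsPartialOrder.trans O.isPartialOrder r (⊏*-old rs)
    ⊏*-old (new _ ◅ () ◅ _)

    extendLabel : Act → Elem (e ∷ X O) → Act
    extendLabel a (_ , here _)  = a
    extendLabel a (x , there p) = O.l (x , p)

    module _ (e∉X : e ∉ X O) where

      ⊏*-reflexive : ∀ {x y} → x ≈ y → Star _⊏_ x y
      ⊏*-reflexive {_ , here refl} {_ , here refl} refl = ε
      ⊏*-reflexive {_ , here refl} {_ , there q}   refl = ⊥-elim (e∉X q)
      ⊏*-reflexive {_ , there p}   {_ , here refl} refl = ⊥-elim (e∉X p)
      ⊏*-reflexive {_ , there p}   {_ , there q}   refl =
        old (IsPartialOrder.reflexive O.isPartialOrder refl) ◅ ε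

      ⊏*-antisym : ∀ {x y} → Star _⊏_ x y → Star _⊏_ y x → x ≈ y
      ⊏*-antisym {_ , here refl} {_ , here refl} _  _        = refl
      ⊏*-antisym {_ , here refl} {_ , there q}   (() ◅ _) _
      ⊏*-antisym {_ , there p}   {_ , here refl} _  (() ◅ _)
      ⊏*-antisym {_ , there p}   {_ , there q}   rs ss       =
        IsPartialOrder.antisym O.isPartialOrder (⊏*-old rs) (⊏*-old ss)

      extendLabel-cong : ∀ a {x y} → x ≈ y → extendLabel a x ≡ extendLabel a y
      extendLabel-cong a {_ , here _}    {_ , here _}    _    = refl
      extendLabel-cong a {_ , here refl} {_ , there q}   refl = ⊥-elim (e∉X q)
      extendLabel-cong a {_ , there p}   {_ , here refl} refl = ⊥-elim (e∉X p)
      extendLabel-cong a {_ , there _}   {_ , there _}   eq   = O.l-cong eq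

  δ : (O : LPoset) → CauseSet → (e : ℰ) → Act → e ∉ X O → LPoset
  δ O K e a e∉X = record
    { X              = e ∷ X O
    ; _≼_            = Star _⊏_
    ; isPartialOrder = record
      { isPreorder = record
        { isEquivalence = On.isEquivalence name isEquivalence
        ; reflexive     = ⊏*-reflexive e∉X
        ; trans         = _◅◅_
        }
      ; antisym = ⊏*-antisym e∉X
      }
    ; l      = extendLabel a
    ; l-cong = λ {x} {y} → extendLabel-cong e∉X a {x} {y}
    }
    where open Extension O K e

  copair : ∀ {X Y : List ℰ} {e} → (Elem X → Elem Y) → Elem Y → Elem (e ∷ X) → Elem Y
  copair f z (_ , here _)  = z
  copair f z (x , there p) = f (x , p)

  record CanonicalPosets : Set₁ where
    field
      [_]     : LPoset → LPoset
      []-cong : ∀ {O O′} → O ≅ O′ → [ O ] ≈ₚ [ O′ ]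
      α       : ∀ O → Event O → Event [ O ]
      α-isIso : ∀ O → IsIsomorphism O [ O ] (α O)
      α-cong  : ∀ {O O′} → O ≈ₚ O′ → ∀ {x : Event O} {x′ : Event O′} →
                name x ≡ name x′ → name (α O x) ≡ name (α O′ x′)

    IsAbstract : LPoset → Set
    IsAbstract O = [ O ] ≈ₚ O

  module Abstract (infinite : Infinite ℰ) (canonical : CanonicalPosets) where
    open CanonicalPosets canonical

    AbstractPoset : Set₁
    AbstractPoset = ∃ IsAbstract

    poset : AbstractPoset → LPoset
    poset = proj₁

    abstraction : LPoset → AbstractPoset
    abstraction O = [ O ] , []-cong (IsIsomorphism.inverse i , record
      { isMorphism         = IsIsomorphism.inverse-isMorphism i
      ; inverse            = α O
      ; inverse-isMorphism = IsIsomorphism.isMorphism i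
      ; inverseᵇ           = swap (IsIsomorphism.inverseᵇ i)
      })
      where i = α-isIso O

    α⊆ : ∀ O {K} (K⊆ : All ∣ O ∣ K) → All ∣ [ O ] ∣ (image {O} (α O) K⊆)
    α⊆ O = image⊆ (α O) (IsIsomorphism.isMorphism (α-isIso O))

    -- The choice of fresh event is irrelevant up to _≈ₚ_, by []-cong.

    δᵃ : AbstractPoset → CauseSet → Act → LPoset
    δᵃ (O , _) K a = [ δ O K (proj₁ (infinite (X O))) a (proj₂ (infinite (X O))) ]

    -- That new and old correspond to the added event and to the inclusion
    -- means that together they form an isomorphism from δ(O,K,eₐ).

    record ExtensionChoice : Set₁ where
      field
        new : ∀ O {K} → All ∣ poset O ∣ K → ∀ a → Event (δᵃ O K a)
        old : ∀ O {K} → All ∣ poset O ∣ K → ∀ a → Event (poset O) → Event (δᵃ O K a)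
        copair-isIso : ∀ O {K} (K⊆ : All ∣ poset O ∣ K) a e (e∉X : e ∉ X (poset O)) →
          IsIsomorphism (δ (poset O) K e a e∉X) (δᵃ O K a) (copair (old O K⊆ a) (new O K⊆ a))
        new-cong : ∀ {O O′ K K′} (K⊆ : All ∣ poset O ∣ K) (K′⊆ : All ∣ poset O′ ∣ K′) a →
          poset O ≈ₚ poset O′ → K ≈ᵏ K′ → name (new O K⊆ a) ≡ name (new O′ K′⊆ a)
        old-cong : ∀ {O O′ K K′} (K⊆ : All ∣ poset O ∣ K) (K′⊆ : All ∣ poset O′ ∣ K′) a →
          poset O ≈ₚ poset O′ → K ≈ᵏ K′ →
          ∀ {x : Event (poset O)} {x′ : Event (poset O′)} → name x ≡ name x′ →
          name (old O K⊆ a x) ≡ name (old O′ K′⊆ a x′)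

module CaseGraphs {Act : Set} (ℰ : Set) (N : Net Act) where
  open Net N
  open Posets Act ℰ public

  CausalMarking : Set
  CausalMarking = List (CauseSet × S)

  open Setoid (FinSet (FinSet (setoid LEvent) ×ₛ setoid S)) public
    using () renaming (_≈_ to _≈ᵐ_)

  𝒦 : CausalMarking → CauseSet
  𝒦 = concatMap proj₁

  places : CausalMarking → List S
  places = map proj₂

  infix 6 _⊢_

  _⊢_ : CauseSet → List S → CausalMarking
  K ⊢ m = map (K ,_) m

  -- PMarking O is the type of P-markings O ▷ c, for fixed O.

  record PMarking (O : LPoset) : Set where
    constructor pmarking
    field
      marking : CausalMarking
      valid   : All (DownClosed O ∘ proj₁) marking

  open PMarking public using (marking)

  renameMarking : ∀ {O Y} → (Event O → Elem Y) → PMarking O → CausalMarking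
  renameMarking {O} σ (pmarking _ valid) =
    All.reduce (λ { {_ , s} d → image {O} σ (DownClosed.within d) , s }) valid

  image-downClosed : ∀ {O O′ σ} (i : IsIsomorphism O O′ σ) {K} (d : DownClosed O K) →
                     DownClosed O′ (image {O} σ (DownClosed.within d))
  image-downClosed {O} {O′} {σ} i {K} d = record
    { within = image⊆ σ m within
    ; closed = λ {x} {y} y∈ x≼y →
        let z , z∈K , eq = image⁻ {O} σ within y∈
            g[x]≼z = IsPartialOrder.trans O.isPartialOrder (IsMorphism.mono n {x} {y} x≼y)
                       (IsPartialOrder.reflexive O.isPartialOrder
                         (proj₂ inverseᵇ {z} {y} (cong proj₁ eq)))
            σgx≈x = proj₁ inverseᵇ {x} {inverse x} refl
        in subst (_∈ image {O} σ within)
             (cong₂ _,_ σgx≈x (O′.l-cong {σ (inverse x)} {x} σgx≈x))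
             (image⁺ σ m within (inverse x) (closed z∈K g[x]≼z))
    }
    where
    module O  = LPoset O
    module O′ = LPoset O′
    open IsIsomorphism i renaming (isMorphism to m; inverse-isMorphism to n)
    open DownClosed d

  rename : ∀ {O O′ σ} → IsIsomorphism O O′ σ → PMarking O → PMarking O′
  rename {O} {O′} {σ} i P@(pmarking _ v) = pmarking (renameMarking {O} σ P) (go v)
    where
    go : ∀ {c} (v : All (DownClosed O ∘ proj₁) c) →
         All (DownClosed O′ ∘ proj₁) (renameMarking {O} σ (pmarking c v))
    go []      = []
    go (d ∷ v) = image-downClosed i d ∷ go v

  -- The transitions of CG_C with label K ⊢ eₐ, closed under equality of posets,
  -- cause sets and markings. As markings are finite, a transition exists only
  -- when t • is finite.

  infix 4 _—[_⊢_∙_]→_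

  record _—[_⊢_∙_]→_ {O O′} (P : PMarking O) (K : CauseSet) (e : ℰ) (a : Act)
                     (P′ : PMarking O′) : Set where
    field
      t       : T
      c c′    : CausalMarking
      post    : List S
      e∉X     : e ∉ X O
      source  : marking P ≈ᵐ c ++ c′
      preset  : (_∈ places c) ≐ (• t)
      postset : (_∈ post) ≐ (t •)
      label   : a ≡ l t
      causes  : (_∈ K) ≐ maximal O (𝒦 c)
      poset′  : O′ ≈ₚ δ O K e a e∉X
      target  : marking P′ ≈ᵐ ((e , a) ∷ 𝒦 c) ⊢ post ++ c′

    K⊆ : All ∣ O ∣ K
    K⊆ = maximal⊆ O {M = 𝒦 c} causes

  -- Indexing P-markings by their poset builds in the requirement that
  -- related P-markings have the poset indexing the relation; resp says that
  -- R is a relation on P-markings up to equality.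

  record IsConcreteBisimulation (R : ∀ O → Rel (PMarking O) (suc 0ℓ)) : Set₁ where
    field
      resp : ∀ {O O′} {P Q : PMarking O} {P′ Q′ : PMarking O′} → O ≈ₚ O′ →
             marking P ≈ᵐ marking P′ → marking Q ≈ᵐ marking Q′ → R O P Q → R O′ P′ Q′
      simˡ : ∀ {O} {P Q : PMarking O} → R O P Q →
             ∀ {K e a O′} {P′ : PMarking O′} → P —[ K ⊢ e ∙ a ]→ P′ →
             Σ[ Q′ ∈ PMarking O′ ] Q —[ K ⊢ e ∙ a ]→ Q′ × R O′ P′ Q′
      simʳ : ∀ {O} {P Q : PMarking O} → R O P Q →
             ∀ {K e a O′} {Q′ : PMarking O′} → Q —[ K ⊢ e ∙ a ]→ Q′ →
             Σ[ P′ ∈ PMarking O′ ] P —[ K ⊢ e ∙ a ]→ P′ × R O′ P′ Q′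

  infix 4 _∼C_

  _∼C_ : ∀ {O} → Rel (PMarking O) (suc (suc 0ℓ))
  _∼C_ {O} P Q = ∃[ R ] IsConcreteBisimulation R × R O P Q

  module AbstractCaseGraph (infinite : Infinite ℰ) (canonical : CanonicalPosets)
           (choice : Posets.Abstract.ExtensionChoice Act ℰ infinite canonical) where
    open CanonicalPosets canonical public
    open Abstract infinite canonical public
    open ExtensionChoice choice public

    -- [O] ▷ cα_O

    abstractMarking : ∀ {O} → PMarking O → PMarking (poset (abstraction O))
    abstractMarking {O} = rename (α-isIso O)

    -- The transition of CG_AC from P to P′ with label L ⊢ a, induced by the
    -- transition from C to C′ of CG_C.

    record AbstractStep (O O′ : AbstractPoset) (P : PMarking (poset O)) (L : CauseSet)
                        (a : Act) (P′ : PMarking (poset O′)) : Set₁ where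
      field
        Ô    : LPoset
        K    : CauseSet
        e    : ℰ
        e∉X  : e ∉ X Ô
        C    : PMarking Ô
        C′   : PMarking (δ Ô K e a e∉X)
        step : C —[ K ⊢ e ∙ a ]→ C′

      open _—[_⊢_∙_]→_ step using (K⊆)

      αK : CauseSet
      αK = image {Ô} (α Ô) K⊆

      -- The isomorphism δ(Ô,K,eₐ) → δ([Ô],α(K),a).

      τ : Event (δ Ô K e a e∉X) → Event (δᵃ (abstraction Ô) αK a)
      τ = copair (old (abstraction Ô) (α⊆ Ô K⊆) a ∘ α Ô) (new (abstraction Ô) (α⊆ Ô K⊆) a)

      field
        poset-source : poset O ≈ₚ [ Ô ]
        source       : marking P ≈ᵐ marking (abstractMarking C)
        label        : L ≈ᵏ αK
        poset-target : poset O′ ≈ₚ δᵃ (abstraction Ô) αK a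
        target       : marking P′ ≈ᵐ renameMarking τ C′

    record IsAbstractBisimulation (R : ∀ O → Rel (PMarking (poset O)) (suc 0ℓ)) : Set₁ where
      field
        resp : ∀ {O O′} {P Q : PMarking (poset O)} {P′ Q′ : PMarking (poset O′)} →
               poset O ≈ₚ poset O′ →
               marking P ≈ᵐ marking P′ → marking Q ≈ᵐ marking Q′ → R O P Q → R O′ P′ Q′
        simˡ : ∀ {O} {P Q : PMarking (poset O)} → R O P Q →
               ∀ {L a O′} {P′ : PMarking (poset O′)} → AbstractStep O O′ P L a P′ →
               Σ[ Q′ ∈ PMarking (poset O′) ] AbstractStep O O′ Q L a Q′ × R O′ P′ Q′
        simʳ : ∀ {O} {P Q : PMarking (poset O)} → R O P Q →
               ∀ {L a O′} {Q′ : PMarking (poset O′)} → AbstractStep O O′ Q L a Q′ →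
               Σ[ P′ ∈ PMarking (poset O′) ] AbstractStep O O′ P L a P′ × R O′ P′ Q′

    infix 4 _▷_∼AC_

    _▷_∼AC_ : ∀ O → Rel (PMarking (poset O)) (suc (suc 0ℓ))
    O ▷ P ∼AC Q = ∃[ R ] IsAbstractBisimulation R × R O P Q

{-# OPTIONS --safe #-}
module Submission where

-- Both case graphs are invariant under renaming events along isomorphisms, fresh
-- events included. Hence the image of a concrete bisimulation under all isomorphisms
-- onto abstract posets is an abstract bisimulation, and the preimage of an abstract
-- bisimulation under all such isomorphisms is a concrete one. Arbitrary isomorphisms
-- are needed rather than just α, since after a transition α and the chosen old and new
-- may differ by an automorphism. In the abstract-to-concrete direction the answering step
-- may be induced by another concrete step; congruence of old and new makes the two
-- target renamings agree.

open import Defs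
open import Data.Empty using (⊥-elim)
open import Data.List.Base using (List; []; _∷_; _++_; concatMap)
open import Data.List.Membership.Propositional using (_∈_; _∉_; find; lose)
open import Data.List.Membership.Propositional.Properties 
  using (∈-++⁺ˡ; ∈-++⁺ʳ; ∈-++⁻; ∈-concatMap⁺; ∈-concatMap⁻; ∈-map⁺; ∈-map⁻)
open import Data.List.Relation.Binary.Pointwise using (Pointwise; []; _∷_)
open import Data.List.Relation.Unary.All using (All; []; _∷_; lookup)
open import Data.List.Relation.Unary.Any using (Any; here; there)
open import Data.Product.Base using (Σ-syntax; ∃-syntax; _×_; _,_; proj₁; proj₂)
open import Data.Sum.Base using (inj₁; inj₂)
open import Function.Base using (flip; id; _∘_)
open import Function.Bundles using (_⇔_; mk⇔; Equivalence)
open import Level using (0ℓ; suc)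
open import Relation.Binary.Construct.Closure.ReflexiveTransitive using (Star; ε; _◅_)
open import Relation.Binary.Core using (REL; Rel; _⇒_)
open import Relation.Binary.PropositionalEquality using (_≡_; refl; sym; trans; cong; cong₂; subst)
open import Relation.Binary.Structures using (IsPartialOrder)

open Equivalence using (to; from)

-- Egli-Milner lifting of relations to lists.

infixr 9 _⨾_

_⨾_ : {A B C : Set} → REL A B 0ℓ → REL B C 0ℓ → REL A C 0ℓ
(Q ⨾ Q′) x z = ∃[ y ] Q x y × Q′ y z

-- Finite sets are lists up to mutual inclusion, so order and multiplicity must not matter when a
-- relation is lifted. For equality this is mutual inclusion itself. Nesting it carries a relation
-- on event names to cause sets and then to markings.
record EgliMilner {A B : Set} (Q : REL A B 0ℓ) (xs : List A) (ys : List B) : Set where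
  field
    forth : ∀ {x} → x ∈ xs → ∃[ y ] y ∈ ys × Q x y
    back  : ∀ {y} → y ∈ ys → ∃[ x ] x ∈ xs × Q x y

open EgliMilner

module _ {A B : Set} where

  em-map : {Q Q′ : REL A B 0ℓ} → Q ⇒ Q′ → EgliMilner Q ⇒ EgliMilner Q′
  em-map f r = record
    { forth = λ x∈ → let y , y∈ , q = forth r x∈ in y , y∈ , f q
    ; back  = λ y∈ → let x , x∈ , q = back r y∈ in x , x∈ , f q
    }

  em-flip : {Q : REL A B 0ℓ} → ∀ {xs ys} → EgliMilner Q xs ys → EgliMilner (flip Q) ys xs
  em-flip r = record { forth = back r ; back = forth r }

  em-[] : {Q : REL A B 0ℓ} → EgliMilner Q [] []
  em-[] = record { forth = λ () ; back = λ () }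

  em-∷ : {Q : REL A B 0ℓ} → ∀ {x y xs ys} → Q x y → EgliMilner Q xs ys → EgliMilner Q (x ∷ xs) (y ∷ ys)
  em-∷ q r = record
    { forth = λ { (here refl) → _ , here refl , q
                ; (there x∈)  → let y , y∈ , q′ = forth r x∈ in y , there y∈ , q′ }
    ; back  = λ { (here refl) → _ , here refl , q
                ; (there y∈)  → let x , x∈ , q′ = back r y∈ in x , there x∈ , q′ }
    }

  em-++ : {Q : REL A B 0ℓ} → ∀ {xs xs′ ys ys′} → EgliMilner Q xs ys → EgliMilner Q xs′ ys′ →
          EgliMilner Q (xs ++ xs′) (ys ++ ys′)
  em-++ {Q} {xs} {xs′} {ys} {ys′} r r′ = record { forth = f ; back = g }
    where
    f : ∀ {x} → x ∈ xs ++ xs′ → ∃[ y ] y ∈ ys ++ ys′ × Q x y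
    f x∈ with ∈-++⁻ xs x∈
    ... | inj₁ i = let y , j , q = forth r i in y , ∈-++⁺ˡ j , q
    ... | inj₂ i = let y , j , q = forth r′ i in y , ∈-++⁺ʳ ys j , q
    g : ∀ {y} → y ∈ ys ++ ys′ → ∃[ x ] x ∈ xs ++ xs′ × Q x y
    g y∈ with ∈-++⁻ ys y∈
    ... | inj₁ j = let x , i , q = back r j in x , ∈-++⁺ˡ i , q
    ... | inj₂ j = let x , i , q = back r′ j in x , ∈-++⁺ʳ xs i , q

  pointwise⇒em : {Q : REL A B 0ℓ} → Pointwise Q ⇒ EgliMilner Q
  pointwise⇒em []       = em-[]
  pointwise⇒em (q ∷ qs) = em-∷ q (pointwise⇒em qs)

  pointwise-choice : {Q : REL A B 0ℓ} → ∀ xs → (∀ {x} → x ∈ xs → ∃[ y ] Q x y) →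
                     ∃[ ys ] Pointwise Q xs ys
  pointwise-choice []       f = [] , []
  pointwise-choice (x ∷ xs) f =
    let y , q = f (here refl) ; ys , qs = pointwise-choice xs (λ i → f (there i)) in y ∷ ys , q ∷ qs

em-concatMap : {A A′ B B′ : Set} {Q : REL A B 0ℓ} {Q′ : REL A′ B′ 0ℓ}
               {f : A → List A′} {g : B → List B′} →
               (∀ {x y} → Q x y → EgliMilner Q′ (f x) (g y)) →
               ∀ {xs ys} → EgliMilner Q xs ys → EgliMilner Q′ (concatMap f xs) (concatMap g ys)
em-concatMap {f = f} {g} h {xs} {ys} r = record
  { forth = λ z∈ → let x , x∈ , z∈fx = find (∈-concatMap⁻ f {xs = xs} z∈)
                       y , y∈ , q = forth r x∈
                       w , w∈gy , q′ = forth (h q) z∈fx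
                   in w , ∈-concatMap⁺ g (lose y∈ w∈gy) , q′
  ; back  = λ w∈ → let y , y∈ , w∈gy = find (∈-concatMap⁻ g {xs = ys} w∈)
                       x , x∈ , q = back r y∈
                       z , z∈fx , q′ = back (h q) w∈gy
                   in z , ∈-concatMap⁺ f (lose x∈ z∈fx) , q′
  }

em-compose : {A B C : Set} {Q : REL A B 0ℓ} {Q′ : REL B C 0ℓ} → ∀ {xs ys zs} →
             EgliMilner Q xs ys → EgliMilner Q′ ys zs → EgliMilner (Q ⨾ Q′) xs zs
em-compose r r′ = record
  { forth = λ x∈ → let y , y∈ , q = forth r x∈ ; z , z∈ , q′ = forth r′ y∈ in z , z∈ , y , q , q′
  ; back  = λ z∈ → let y , y∈ , q′ = back r′ z∈ ; x , x∈ , q = back r y∈ in x , x∈ , y , q , q′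
  }

-- Relations between event names.

data Extend {ℰ : Set} (R : Rel ℰ 0ℓ) (e e′ : ℰ) : Rel ℰ 0ℓ where
  new : Extend R e e′ e e′
  old : R ⇒ Extend R e e′

-- The value of `σ` could depend on the membership proof, so the proof is quantified away.
-- Single-valuedness comes only with a `Correspondence`.
Graph : {ℰ : Set} {X Y : List ℰ} → (∃[ x ] x ∈ X → ∃[ y ] y ∈ Y) → Rel ℰ 0ℓ
Graph σ x y = ∃[ p ] proj₁ (σ (x , p)) ≡ y

-- Equality of posets and isomorphisms as relations.

module _ {Act ℰ : Set} where
  open Posets Act ℰ

  ≈ₚ-sym : ∀ {O O′} → O ≈ₚ O′ → O′ ≈ₚ O
  ≈ₚ-sym eq = record
    { events = proj₂ events , proj₁ events
    ; order  = λ {x} {y} {x′} {y′} p q →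
        let e = order {x′} {y′} {x} {y} (sym p) (sym q) in mk⇔ (from e) (to e)
    ; labels = λ {x} {x′} p → sym (labels {x′} {x} (sym p))
    }
    where open _≈ₚ_ eq

  ≈ₚ-trans : ∀ {O O′ O″} → O ≈ₚ O′ → O′ ≈ₚ O″ → O ≈ₚ O″
  ≈ₚ-trans eq eq′ = record
    { events = proj₁ F.events ∘ proj₁ E.events , proj₂ E.events ∘ proj₂ F.events
    ; order  = λ {x} {y} {x″} {y″} p q →
        let x′ = name x , proj₁ E.events (proj₂ x) ; y′ = name y , proj₁ E.events (proj₂ y)
            e = E.order {x} {y} {x′} {y′} refl refl
            f = F.order {x′} {y′} {x″} {y″} p q
        in mk⇔ (to f ∘ to e) (from e ∘ from f)
    ; labels = λ {x} {x″} p →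
        let x′ = name x , proj₁ E.events (proj₂ x)
        in trans (E.labels {x} {x′} refl) (F.labels {x′} {x″} p)
    }
    where
    module E = _≈ₚ_ eq
    module F = _≈ₚ_ eq′

  ≈ₚ-refl : ∀ {O} → O ≈ₚ O
  ≈ₚ-refl {O} = record
    { events = id , id
    ; order  = λ {x} {y} {x′} {y′} p q → mk⇔
        (λ z → ≼-trans (≼-reflexive {x′} {x} (sym p)) (≼-trans z (≼-reflexive {y} {y′} q)))
        (λ z → ≼-trans (≼-reflexive {x} {x′} p) (≼-trans z (≼-reflexive {y′} {y} (sym q))))
    ; labels = λ {x} {x′} → l-cong {x} {x′}
    }
    where
    open LPoset O using (isPartialOrder; l-cong)
    open IsPartialOrder isPartialOrder using () renaming (trans to ≼-trans; reflexive to ≼-reflexive)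

  -- An isomorphism, as a relation between event names. Names escape the choice of
  -- membership proofs, and inverses are obtained by flipping.

  record Correspondence (O O′ : LPoset) (R : Rel ℰ 0ℓ) : Set where
    private
      module O  = LPoset O
      module O′ = LPoset O′
    field
      within     : ∀ {x x′} → R x x′ → x ∈ X O × x′ ∈ X O′
      total      : ∀ {x} → x ∈ X O → ∃[ x′ ] R x x′
      surjective : ∀ {x′} → x′ ∈ X O′ → ∃[ x ] R x x′
      order      : ∀ {x y : Event O} {x′ y′ : Event O′} →
                   R (name x) (name x′) → R (name y) (name y′) → (x O.≼ y) ⇔ (x′ O′.≼ y′)
      labels     : ∀ {x : Event O} {x′ : Event O′} → R (name x) (name x′) → O.l x ≡ O′.l x′

    -- Reading `order` at `x ≼ x` with the partners `x′` and `x″`, in both orders, gives `x′ ≼ x″`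
    -- and `x″ ≼ x′`; antisymmetry concludes. Injectivity is the same fact for the inverse.
    functional : ∀ {x x′ x″} → R x x′ → R x x″ → x′ ≡ x″
    functional {x} {x′} {x″} r s =
      IsPartialOrder.antisym O′.isPartialOrder {x′ , p′} {x″ , p″}
        (to (order {x , p} {x , p} r s) (IsPartialOrder.refl O.isPartialOrder))
        (to (order {x , p} {x , p} s r) (IsPartialOrder.refl O.isPartialOrder))
      where
      p  = proj₁ (within r)
      p′ = proj₂ (within r)
      p″ = proj₂ (within s)

  open Correspondence public

  module _ {O O′ : LPoset} {R : Rel ℰ 0ℓ} where

    inverse : Correspondence O O′ R → Correspondence O′ O (flip R)
    inverse c = record
      { within     = λ r → let p , p′ = within c r in p′ , p
      ; total      = surjective c
      ; surjective = total c
      ; order      = λ {x} {y} {x′} {y′} r s →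
          let e = order c {x′} {y′} {x} {y} r s in mk⇔ (from e) (to e)
      ; labels     = λ {x} {x′} r → sym (labels c {x′} {x} r)
      }

    compose : ∀ {O″ R′} → Correspondence O O′ R → Correspondence O′ O″ R′ →
              Correspondence O O″ (R ⨾ R′)
    compose c c′ = record
      { within     = λ (_ , r , r′) → proj₁ (within c r) , proj₂ (within c′ r′)
      ; total      = λ p → let x′ , r = total c p
                               x″ , r′ = total c′ (proj₂ (within c r)) in x″ , x′ , r , r′
      ; surjective = λ p → let x′ , r′ = surjective c′ p
                               x , r = surjective c (proj₁ (within c′ r′)) in x , x′ , r , r′
      ; order      = λ {x} {y} {x″} {y″} (x′ , r , r′) (y′ , s , s′) →
          let p = proj₂ (within c r) ; q = proj₂ (within c s)
              e = order c {x} {y} {x′ , p} {y′ , q} r s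
              e′ = order c′ {x′ , p} {y′ , q} {x″} {y″} r′ s′
          in mk⇔ (λ z → to e′ (to e z)) (λ z → from e (from e′ z))
      ; labels     = λ {x} {x″} (x′ , r , r′) →
          let p = proj₂ (within c r)
          in trans (labels c {x} {x′ , p} r) (labels c′ {x′ , p} {x″} r′)
      }

    respʳ : ∀ {O″} → O′ ≈ₚ O″ → Correspondence O O′ R → Correspondence O O″ R
    respʳ eq c = record
      { within     = λ r → let p , p′ = within c r in p , proj₁ E.events p′
      ; total      = total c
      ; surjective = λ p → surjective c (proj₂ E.events p)
      ; order      = λ {x} {y} {x′} {y′} r s →
          let p = proj₂ (within c r) ; q = proj₂ (within c s)
              e = order c {x} {y} {name x′ , p} {name y′ , q} r s
              e′ = E.order {name x′ , p} {name y′ , q} {x′} {y′} refl refl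
          in mk⇔ (λ z → to e′ (to e z)) (λ z → from e (from e′ z))
      ; labels     = λ {x} {x′} r →
          let p = proj₂ (within c r)
          in trans (labels c {x} {name x′ , p} r) (E.labels {name x′ , p} {x′} refl)
      }
      where module E = _≈ₚ_ eq

  respˡ : ∀ {O O′ O″ R} → O ≈ₚ O″ → Correspondence O O′ R → Correspondence O″ O′ R
  respˡ eq c = inverse (respʳ eq (inverse c))

  -- Membership in `X O` is part of the relation because plain equality would violate `within`.
  identity : ∀ O → Correspondence O O (λ x x′ → x ≡ x′ × x ∈ X O)
  identity O = record
    { within     = λ { (refl , p) → p , p }
    ; total      = λ p → _ , refl , p
    ; surjective = λ p → _ , refl , p
    ; order      = λ {x} {y} {x′} {y′} r s →
        _≈ₚ_.order (≈ₚ-refl {O}) {x} {y} {x′} {y′} (proj₁ r) (proj₁ s)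
    ; labels     = λ {x} {x′} r → LPoset.l-cong O {x} {x′} (proj₁ r)
    }

  fromIso : ∀ {O O′ σ} → IsIsomorphism O O′ σ → Correspondence O O′ (Graph σ)
  fromIso {O} {O′} {σ} i = record
    { within     = λ { (p , refl) → p , proj₂ (σ (_ , p)) }
    ; total      = λ p → _ , p , refl
    ; surjective = λ p → _ , proj₂ (I.inverse (_ , p)) , proj₁ I.inverseᵇ {_ , p} refl
    ; order      = λ {x} {y} {x′} {y′} r s → mk⇔
        (λ z → O′.trans (O′.reflexive {x′} {σ x} (sym (value {x} {x′} r)))
          (O′.trans (M.mono {x} {y} z) (O′.reflexive {σ y} {y′} (value {y} {y′} s))))
        (λ z → O.trans (O.reflexive {x} {I.inverse x′} (sym (back-value {x} {x′} r)))
          (O.trans (W.mono {x′} {y′} z) (O.reflexive {I.inverse y′} {y} (back-value {y} {y′} s))))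
    ; labels     = λ {x} {x′} r →
        trans (sym (M.label-preserving x)) (LPoset.l-cong O′ {σ x} {x′} (value {x} {x′} r))
    }
    where
    module I  = IsIsomorphism i
    module M  = IsMorphism I.isMorphism
    module W  = IsMorphism I.inverse-isMorphism
    module O  = IsPartialOrder (LPoset.isPartialOrder O)
    module O′ = IsPartialOrder (LPoset.isPartialOrder O′)
    value : ∀ {x : Event O} {x′ : Event O′} → Graph σ (name x) (name x′) → name (σ x) ≡ name x′
    value {x} (p , eq) = trans (M.≈-cong {x} {name x , p} refl) eq
    back-value : ∀ {x : Event O} {x′ : Event O′} → Graph σ (name x) (name x′) →
                 name (I.inverse x′) ≡ name x
    back-value {x} {x′} r = proj₂ I.inverseᵇ {x} {x′} (sym (value {x} {x′} r))

  module _ {O O′ : LPoset} {R : Rel ℰ 0ℓ} (c : Correspondence O O′ R) where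

    -- `rename` and `[]-cong` ask for actual isomorphisms; the witnesses of `total` supply them
    -- without any choice principle.
    function : Event O → Event O′
    function (x , p) = let x′ , r = total c p in x′ , proj₂ (within c r)

    function-related : ∀ x → R (name x) (name (function x))
    function-related (_ , p) = proj₂ (total c p)

    function-isMorphism : IsMorphism O O′ function
    function-isMorphism = record
      { isOrderHomomorphism = record
        { cong = λ {x} {y} eq → functional c (function-related x)
                   (subst (λ z → R z (name (function y))) (sym eq) (function-related y))
        ; mono = λ {x} {y} → to (order c {x} {y} (function-related x) (function-related y))
        }
      ; label-preserving = λ x → sym (labels c {x} {function x} (function-related x))
      }

  module _ {O O′ : LPoset} {R : Rel ℰ 0ℓ} (c : Correspondence O O′ R) where

    function-isIsomorphism : IsIsomorphism O O′ (function c)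
    function-isIsomorphism = record
      { isMorphism         = function-isMorphism c
      ; inverse            = function (inverse c)
      ; inverse-isMorphism = function-isMorphism (inverse c)
      ; inverseᵇ           =
          (λ {x} {y} eq → functional c (function-related c y)
            (subst (λ z → R z (name x)) (sym eq) (function-related (inverse c) x)))
        , (λ {x} {y} eq → functional (inverse c) (function-related (inverse c) y)
            (subst (R (name x)) (sym eq) (function-related c x)))
      }

    graph⇒related : Graph (function c) ⇒ R
    graph⇒related (p , refl) = function-related c (_ , p)

  -- Cause sets and maximal elements under a correspondence.

  record Labelled (R : Rel ℰ 0ℓ) (z w : LEvent) : Set where
    constructor _,_
    field
      related    : R (proj₁ z) (proj₁ w)
      same-label : proj₂ z ≡ proj₂ w

  CauseRel : Rel ℰ 0ℓ → Rel CauseSet 0ℓ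
  CauseRel R = EgliMilner (Labelled R)

  causes-map : ∀ {R R′} → R ⇒ R′ → CauseRel R ⇒ CauseRel R′
  causes-map f = em-map λ (r , eq) → f r , eq

  causes-flip : ∀ {R K L} → CauseRel R K L → CauseRel (flip R) L K
  causes-flip k = em-map (λ (r , eq) → r , sym eq) (em-flip k)

  causes-compose : ∀ {R R′ K L M} → CauseRel R K L → CauseRel R′ L M → CauseRel (R ⨾ R′) K M
  causes-compose k k′ =
    em-map (λ { (_ , (r , refl) , (r′ , refl)) → (_ , r , r′) , refl }) (em-compose k k′)

  causes-≈ : ∀ {K L} → CauseRel _≡_ K L → K ≈ᵏ L
  causes-≈ k = (λ z∈ → let _ , w∈ , r = forth k z∈ in subst (_∈ _) (sym (≡ᴸ r)) w∈)
             , (λ w∈ → let _ , z∈ , r = back k w∈ in subst (_∈ _) (≡ᴸ r) z∈)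
    where
    ≡ᴸ : ∀ {z w} → Labelled _≡_ z w → z ≡ w
    ≡ᴸ (p , q) = cong₂ _,_ p q

  ≈-causes : ∀ {K L} → K ≈ᵏ L → CauseRel _≡_ K L
  ≈-causes (K⊆L , L⊆K) = record
    { forth = λ z∈ → _ , K⊆L z∈ , refl , refl
    ; back  = λ w∈ → _ , L⊆K w∈ , refl , refl
    }

  causes-respʳ : ∀ {R K L M} → CauseRel R K L → L ≈ᵏ M → CauseRel R K M
  causes-respʳ k eq = causes-map (λ { (_ , r , refl) → r }) (causes-compose k (≈-causes eq))

  causes-image : ∀ O {Y} (σ : Event O → Elem Y) {K} (K⊆ : All ∣ O ∣ K) →
                 CauseRel (Graph σ) K (image {O} σ K⊆)
  causes-image O σ []                      = em-[]
  causes-image O σ (((_ , p) , refl) ∷ K⊆) = em-∷ ((p , refl) , refl) (causes-image O σ K⊆)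

  module _ {O O′ : LPoset} {R : Rel ℰ 0ℓ} (c : Correspondence O O′ R) where

    causes-total : ∀ {K} → All ∣ O ∣ K → ∃[ L ] CauseRel R K L
    causes-total K⊆ = _ , causes-map (graph⇒related c) (causes-image O (function c) K⊆)

    causes-functional : ∀ {K L M} → CauseRel R K L → CauseRel R K M → L ≈ᵏ M
    causes-functional k k′ = causes-≈
      (causes-map (λ (_ , r , r′) → functional c r r′) (causes-compose (causes-flip k) k′))

    -- An element `y′` of `M′` above `x′` has a partner `y` in `M`, which lies above `x` because the
    -- order is reflected. Maximality of `x` forces `y` to be `x`, and single-valuedness then
    -- identifies `y′` with `x′`.
    maximal-transfer : ∀ {M M′} → CauseRel R M M′ → ∀ {z z′} → Labelled R z z′ →
                       maximal O M z → maximal O′ M′ z′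
    maximal-transfer {M} {M′} m {z′ = x′ , _} (r , refl) (z∈M , x , refl , x-max)
      with forth m z∈M
    ... | _ , w∈M′ , (s , refl) with functional c r s
    ...   | refl = w∈M′ , (x′ , p′) , cong (x′ ,_) (sym (labels c {x} {x′ , p′} r)) , x′-max
      where
      module O′ = LPoset O′
      p′ = proj₂ (within c r)
      x′-max : ∀ (y′ : Event O′) → O′.labelled y′ ∈ M′ → (x′ , p′) O′.≼ y′ → x′ ≡ name y′
      x′-max y′ y′∈M′ x′≼y′ with back m y′∈M′
      ... | (y , a) , y∈M , (t , refl) = functional c r
        (subst (λ v → R v (name y′)) (sym x≈y) t)
        where
        q = proj₁ (within c t)
        x≈y : name x ≡ y
        x≈y = x-max (y , q) (subst (λ b → (y , b) ∈ M) (sym (labels c {y , q} {y′} t)) y∈M)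
                (from (order c {x} {y , q} {x′ , p′} {y′} r t) x′≼y′)

    -- Inclusion suffices: if `x` is related to `x′`, then `σ` sends `x` to something related to `x`
    -- as well, hence to `x′`. This spares a direct proof that a map defined by cases is an
    -- isomorphism.
    graph-correspondence : ∀ {σ : Event O → Event O′} → Graph σ ⇒ R → Correspondence O O′ (Graph σ)
    graph-correspondence {σ} g = record
      { within     = λ r → within c (g r)
      ; total      = λ p → _ , p , refl
      ; surjective = λ p′ →
          let _ , r = surjective c p′ ; p = proj₁ (within c r) in _ , p , functional c (g (p , refl)) r
      ; order      = λ {x} {y} {x′} {y′} r s → order c {x} {y} {x′} {y′} (g r) (g s)
      ; labels     = λ {x} {x′} r → labels c {x} {x′} (g r)
      }

  -- Correspondences between one-event extensions.

  module _ {O : LPoset} {K : CauseSet} {e : ℰ} where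
    open Extension O K e
    open LPoset O using (_≼_; labelled)

    -- The last link of such a chain must leave from an element of `K`; the links before it stay in
    -- `O` and collapse by transitivity.
    ⊏*-new : ∀ {x p} → Star _⊏_ (x , there p) (e , here refl) →
             ∃[ y ] labelled y ∈ K × (x , p) ≼ y
    ⊏*-new (new y∈K ◅ _) = _ , y∈K , IsPartialOrder.refl (LPoset.isPartialOrder O)
    ⊏*-new (old r ◅ rs)  =
      let y , y∈K , s = ⊏*-new rs in y , y∈K , IsPartialOrder.trans (LPoset.isPartialOrder O) r s

  module _ {O O′ : LPoset} {R : Rel ℰ 0ℓ} {K K′ : CauseSet} {e e′ : ℰ} where
    private
      module E  = Extension O K e
      module E′ = Extension O′ K′ e′

    -- `Extend` sees only names, whereas the order and labels of `δ` are defined by cases on `here`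
    -- and `there`. Freshness makes the two sides fall into the same case, and this type records
    -- that for pattern matching.
    data Match : Elem (e ∷ X O) → Elem (e′ ∷ X O′) → Set where
      new : Match (e , here refl) (e′ , here refl)
      old : ∀ {x p x′ p′} → R x x′ → Match (x , there p) (x′ , there p′)

    match : Correspondence O O′ R → e ∉ X O → e′ ∉ X O′ →
            ∀ {u u′} → Extend R e e′ (name u) (name u′) → Match u u′
    match c e∉ e′∉ {_ , here refl} {_ , here refl} _       = new
    match c e∉ e′∉ {_ , there p}   {_ , there p′}  new     = ⊥-elim (e∉ p)
    match c e∉ e′∉ {_ , there p}   {_ , there p′}  (old r) = old r
    match c e∉ e′∉ {_ , here refl} {_ , there p′}  new     = ⊥-elim (e′∉ p′)
    match c e∉ e′∉ {_ , here refl} {_ , there p′}  (old r) = ⊥-elim (e∉ (proj₁ (within c r)))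
    match c e∉ e′∉ {_ , there p}   {_ , here refl} new     = ⊥-elim (e∉ p)
    match c e∉ e′∉ {_ , there p}   {_ , here refl} (old r) = ⊥-elim (e′∉ (proj₂ (within c r)))

    match-mono : Correspondence O O′ R → CauseRel R K K′ →
                 ∀ {u v u′ v′} → Match u u′ → Match v v′ → Star E._⊏_ u v → Star E′._⊏_ u′ v′
    match-mono c k new     new     _        = ε
    match-mono c k (old {x} {p} {x′} {p′} r) (old {y} {q} {y′} {q′} s) rs =
      E′.old (to (order c {x , p} {y , q} {x′ , p′} {y′ , q′} r s) (E.⊏*-old rs)) ◅ ε
    match-mono c k new     (old _) (() ◅ _)
    -- The chain passes below some `y` in `K`; the partner of `y` in `K′` is where the new chain
    -- jumps to `e′`.
    match-mono c k (old {x} {p} {x′} {p′} r) new rs =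
      let y , y∈K , x≼y        = ⊏*-new {O} {K} rs
          (y′ , _) , y′∈K , s , eq = forth k y∈K
          q′ = proj₂ (within c s)
      in E′.old (to (order c {x , p} {y} {x′ , p′} {y′ , q′} r s) x≼y)
         ◅ E′.new (subst (λ b → (y′ , b) ∈ K′)
                    (trans (sym eq) (labels c {y} {y′ , q′} s)) y′∈K)
         ◅ ε

  match-flip : ∀ {O O′ R K K′ e e′ u u′} → Match {O} {O′} {R} {K} {K′} {e} {e′} u u′ →
               Match {O′} {O} {flip R} {K′} {K} {e′} {e} u′ u
  match-flip new     = new
  match-flip (old r) = old r

  -- The two fresh names are independent of each other, so a step can be moved to any other fresh
  -- name. The reflecting half of `order` is `match-mono` for the inverse.
  extend : ∀ {O O′ R K K′ e e′} a (e∉ : e ∉ X O) (e′∉ : e′ ∉ X O′) →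
           Correspondence O O′ R → CauseRel R K K′ →
           Correspondence (δ O K e a e∉) (δ O′ K′ e′ a e′∉) (Extend R e e′)
  extend {O} {O′} {R} {K} {K′} {e} {e′} a e∉ e′∉ c k = record
    { within     = λ { new     → here refl , here refl
                     ; (old r) → let p , p′ = within c r in there p , there p′ }
    ; total      = λ { (here refl) → _ , new ; (there p) → let _ , r = total c p in _ , old r }
    ; surjective = λ { (here refl) → _ , new ; (there p) → let _ , r = surjective c p in _ , old r }
    ; order      = λ {x} {y} {x′} {y′} r s →
        let m = ⇒match {x} {x′} r ; n = ⇒match {y} {y′} s in mk⇔
          (match-mono c k m n)
          (match-mono (inverse c) (causes-flip k) (match-flip m) (match-flip n))
    ; labels     = λ {x} {x′} r → match-labels (⇒match {x} {x′} r)
    }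
    where
    ⇒match : ∀ {u u′} → Extend R e e′ (name u) (name u′) → Match {O} {O′} {R} {K} {K′} u u′
    ⇒match {u} {u′} = match c e∉ e′∉ {u} {u′}
    match-labels : ∀ {u u′} → Match {O} {O′} {R} {K} {K′} u u′ →
      Extension.extendLabel O K e a u ≡ Extension.extendLabel O′ K′ e′ a u′
    match-labels new     = refl
    match-labels (old {x} {p} {x′} {p′} r) = labels c {x , p} {x′ , p′} r

-- Causal markings and the transfer of concrete steps.

module _ {Act ℰ : Set} (N : Net Act) where
  open CaseGraphs ℰ N
  open Net N using (S)

  record Marked (R : Rel ℰ 0ℓ) (m m′ : CauseSet × S) : Set where
    constructor _,_
    field
      causes     : CauseRel R (proj₁ m) (proj₁ m′)
      same-place : proj₂ m ≡ proj₂ m′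

  MarkingRel : Rel ℰ 0ℓ → Rel CausalMarking 0ℓ
  MarkingRel R = EgliMilner (Marked R)

  marking-map : ∀ {R R′} → R ⇒ R′ → MarkingRel R ⇒ MarkingRel R′
  marking-map f = em-map λ (k , eq) → causes-map f k , eq

  marking-flip : ∀ {R c d} → MarkingRel R c d → MarkingRel (flip R) d c
  marking-flip m = em-map (λ (k , eq) → causes-flip k , sym eq) (em-flip m)

  marking-compose : ∀ {R R′ c d f} → MarkingRel R c d → MarkingRel R′ d f → MarkingRel (R ⨾ R′) c f
  marking-compose m m′ =
    em-map (λ { (_ , (k , refl) , (k′ , refl)) → causes-compose k k′ , refl }) (em-compose m m′)

  ≈-marking : ∀ {c d} → c ≈ᵐ d → MarkingRel _≡_ c d
  ≈-marking (c⊆d , d⊆c) = record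
    -- Inclusion of markings speaks of membership up to equality of cause sets, so propositional
    -- membership is first weakened by the reflexive proof `(id , id) , refl`.
    { forth = λ m∈ → let _ , m′∈ , eq , eq′ = find (c⊆d (lose m∈ ((id , id) , refl)))
                     in _ , m′∈ , ≈-causes eq , eq′
    ; back  = λ m∈ → let _ , m′∈ , (p , q) , eq′ = find (d⊆c (lose m∈ ((id , id) , refl)))
                     in _ , m′∈ , ≈-causes (q , p) , sym eq′
    }

  marking-≈ : ∀ {c d} → MarkingRel _≡_ c d → c ≈ᵐ d
  marking-≈ {c} {d} m = included m , included (marking-map sym (marking-flip m))
    where
    _≈ᵖ_ : Rel (CauseSet × S) 0ℓ
    (K , s) ≈ᵖ (L , s′) = K ≈ᵏ L × s ≡ s′
    included : ∀ {c d} → MarkingRel _≡_ c d → ∀ {x} → Any (x ≈ᵖ_) c → Any (x ≈ᵖ_) d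
    included m x∈ =
      let _ , y∈ , (p , q) , eq = find x∈
          _ , z∈ , k , eq′ = forth m y∈
          p′ , q′ = causes-≈ k
      in lose z∈ ((p′ ∘ p , q ∘ q′) , trans eq eq′)

  marking-respʳ : ∀ {R c d f} → MarkingRel R c d → d ≈ᵐ f → MarkingRel R c f
  marking-respʳ m eq = marking-map (λ { (_ , r , refl) → r }) (marking-compose m (≈-marking eq))

  ≈ᵐ-sym : ∀ {c d} → c ≈ᵐ d → d ≈ᵐ c
  ≈ᵐ-sym (p , q) = q , p

  marking-respˡ : ∀ {R c d f} → c ≈ᵐ d → MarkingRel R c f → MarkingRel R d f
  marking-respˡ eq m = marking-flip (marking-respʳ (marking-flip m) eq)

  𝒦-related : ∀ {R c d} → MarkingRel R c d → CauseRel R (𝒦 c) (𝒦 d)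
  𝒦-related = em-concatMap Marked.causes

  ⊢-related : ∀ {R K L} → CauseRel R K L → ∀ m → MarkingRel R (K ⊢ m) (L ⊢ m)
  ⊢-related k []      = em-[]
  ⊢-related k (_ ∷ m) = em-∷ (k , refl) (⊢-related k m)

  places-related : ∀ {R c d} → MarkingRel R c d → ∀ {s} → s ∈ places c → s ∈ places d
  places-related m s∈ with ∈-map⁻ proj₂ s∈
  ... | _ , m∈ , refl with forth m m∈
  ...   | _ , m′∈ , _ , refl = ∈-map⁺ proj₂ m′∈

  renameMarking-related : ∀ {O Y} (σ : Event O → Elem Y) (P : PMarking O) →
                          MarkingRel (Graph σ) (marking P) (renameMarking {O} σ P)
  renameMarking-related {O} σ (pmarking _ v) = go v
    where
    go : ∀ {c} (v : All (DownClosed O ∘ proj₁) c) →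
         MarkingRel (Graph σ) c (renameMarking {O} σ (pmarking c v))
    go []      = em-[]
    go (d ∷ v) = em-∷ (causes-image O σ (DownClosed.within d) , refl) (go v)

  module _ {O O′ : LPoset} {R : Rel ℰ 0ℓ} (c : Correspondence O O′ R) where

    marking-transport : (P : PMarking O) → Σ[ P′ ∈ PMarking O′ ] MarkingRel R (marking P) (marking P′)
    marking-transport P = rename (function-isIsomorphism c) P ,
      marking-map (graph⇒related c) (renameMarking-related {O} (function c) P)

    marking-functional : ∀ {m m′ m″} → MarkingRel R m m′ → MarkingRel R m m″ → m′ ≈ᵐ m″
    marking-functional k k′ = marking-≈
      (marking-map (λ (_ , r , r′) → functional c r r′) (marking-compose (marking-flip k) k′))

  -- Every ingredient of a transition is determined by the order and labels, so it survives renaming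
  -- along `R`, provided that the renaming `R′` of the target extends `R` and pairs the added
  -- events. The target poset is given only up to `≈ₚ`, which lets the lemma serve in both
  -- directions.
  step-transfer :
    ∀ {O Ô O′ Ô′ R R′} → Correspondence O Ô R → Correspondence O′ Ô′ R′ → R ⇒ R′ →
    ∀ {e ê} → R′ e ê → (ê∉ : ê ∉ X Ô) →
    ∀ {K K̂ a} → CauseRel R K K̂ → Ô′ ≈ₚ δ Ô K̂ ê a ê∉ →
    ∀ {P : PMarking O} {P′ : PMarking O′} {C : PMarking Ô} {C′ : PMarking Ô′} →
    MarkingRel R (marking P) (marking C) → MarkingRel R′ (marking P′) (marking C′) →
    P —[ K ⊢ e ∙ a ]→ P′ → C —[ K̂ ⊢ ê ∙ a ]→ C′
  step-transfer {Ô = Ô} {R = R} {R′} cor cor′ R⇒R′ {e} {ê} eRê ê∉ {K} {K̂} {a} k eq m m′ st = record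
    { t       = t
    ; c       = ĉ
    ; c′      = ĉ′
    ; post    = post
    ; e∉X     = ê∉
    ; source  = marking-functional cor cc′~C (em-++ c~ĉ c′~ĉ′)
    ; preset  = proj₁ preset ∘ places-related (marking-flip c~ĉ)
              , places-related c~ĉ ∘ proj₂ preset
    ; postset = postset
    ; label   = label
    ; causes  = K̂⇒max , max⇒K̂
    ; poset′  = eq
    ; target  = marking-functional cor′ m′ (marking-respˡ (≈ᵐ-sym target)
                  (em-++ (⊢-related (em-∷ (eRê , refl) (causes-map R⇒R′ 𝒦~)) post)
                         (marking-map R⇒R′ c′~ĉ′)))
    }
    where
    open _—[_⊢_∙_]→_ st
    cc′~C = marking-respˡ source m
    -- `marking C` comes with no splitting of its own. Collecting partners of the entries of `c` and
    -- of `c′` yields one, and it covers `marking C` because images under `R` are unique.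
    chosen  = pointwise-choice c  λ x∈ → let y , _ , q = forth cc′~C (∈-++⁺ˡ x∈) in y , q
    chosen′ = pointwise-choice c′ λ x∈ → let y , _ , q = forth cc′~C (∈-++⁺ʳ c x∈) in y , q
    ĉ  = proj₁ chosen
    ĉ′ = proj₁ chosen′
    c~ĉ : MarkingRel R c ĉ
    c~ĉ = pointwise⇒em (proj₂ chosen)
    c′~ĉ′ : MarkingRel R c′ ĉ′
    c′~ĉ′ = pointwise⇒em (proj₂ chosen′)
    𝒦~ : CauseRel R (𝒦 c) (𝒦 ĉ)
    𝒦~ = 𝒦-related c~ĉ
    K̂⇒max : ∀ {z} → z ∈ K̂ → maximal Ô (𝒦 ĉ) z
    K̂⇒max z∈ = let _ , w∈ , r = back k z∈ in maximal-transfer cor 𝒦~ r (proj₁ causes w∈)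
    -- The partner of `z` in `𝒦 c` is maximal there, hence lies in `K`; its own partner in `K̂` can
    -- only be `z`.
    max⇒K̂ : ∀ {z} → maximal Ô (𝒦 ĉ) z → z ∈ K̂
    max⇒K̂ z-max with back 𝒦~ (proj₁ z-max)
    ... | w , _ , (r , refl)
      with forth k (proj₂ causes (maximal-transfer (inverse cor) (causes-flip 𝒦~) (r , refl) z-max))
    ...   | _ , v∈ , (s , refl) with functional cor r s
    ...     | refl = v∈

-- Naming of the extended events in the abstract case graph.

module _ {Act ℰ : Set} (infinite : Infinite ℰ) (N : Net Act)
         (canonical : Posets.CanonicalPosets Act ℰ)
         (choice : Posets.Abstract.ExtensionChoice Act ℰ infinite canonical) where
  open CaseGraphs ℰ N
  open AbstractCaseGraph infinite canonical choice renaming (new to newᵃ; old to oldᵃ)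

  -- The renaming τ of an abstract step, for an arbitrary proof that K ⊆ |Ô|.

  extensionMap : ∀ Ô {K} (K⊆ : All ∣ Ô ∣ K) e a →
                 Elem (e ∷ X Ô) → Event (δᵃ (abstraction Ô) (image {Ô} (α Ô) K⊆) a)
  extensionMap Ô K⊆ e a =
    copair (oldᵃ (abstraction Ô) (α⊆ Ô K⊆) a ∘ α Ô) (newᵃ (abstraction Ô) (α⊆ Ô K⊆) a)

  α-correspondence : ∀ O → Correspondence O [ O ] (Graph (α O))
  α-correspondence O = fromIso (α-isIso O)

  α-irrelevant : ∀ O {x p q} → name (α O (x , p)) ≡ name (α O (x , q))
  α-irrelevant O = IsMorphism.≈-cong (IsIsomorphism.isMorphism (α-isIso O)) refl

  -- The map factors as `α Ô` extended by `e ↦ ê`, followed by the isomorphism that `copair-isIso`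
  -- provides for the fresh event `ê` of `[ Ô ]`.
  extensionMap-correspondence :
    ∀ Ô {K} (K⊆ : All ∣ Ô ∣ K) {e} a (e∉ : e ∉ X Ô) →
    Correspondence (δ Ô K e a e∉) (δᵃ (abstraction Ô) (image {Ô} (α Ô) K⊆) a)
                   (Graph (extensionMap Ô K⊆ e a))
  extensionMap-correspondence Ô {K} K⊆ {e} a e∉ = graph-correspondence
    (compose (extend a e∉ ê∉ (α-correspondence Ô) (causes-image Ô (α Ô) K⊆)) (fromIso iso))
    {extensionMap Ô K⊆ e a} factor
    where
    ê = proj₁ (infinite (X [ Ô ]))
    ê∉ = proj₂ (infinite (X [ Ô ]))
    ν : Elem (ê ∷ X [ Ô ]) → Event (δᵃ (abstraction Ô) (image {Ô} (α Ô) K⊆) a)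
    ν = copair (oldᵃ (abstraction Ô) (α⊆ Ô K⊆) a) (newᵃ (abstraction Ô) (α⊆ Ô K⊆) a)
    iso = copair-isIso (abstraction Ô) (α⊆ Ô K⊆) a ê ê∉
    factor : Graph (extensionMap Ô K⊆ e a) ⇒ Extend (Graph (α Ô)) e ê ⨾ Graph ν
    factor (here refl , refl) = ê , new , here refl , refl
    factor (there p , refl)   = _ , old (p , refl) , there (proj₂ (α Ô (_ , p))) , refl

  -- Different concrete steps may induce the same abstract label. Events that become equal in the
  -- canonical poset, and the two added events, then receive equal final names by `old-cong` and
  -- `new-cong`.
  extensionMap-agree :
    ∀ {Ô₁ Ô₂ K₁ K₂ e₁ e₂ a} (K₁⊆ : All ∣ Ô₁ ∣ K₁) (K₂⊆ : All ∣ Ô₂ ∣ K₂) → e₁ ∉ X Ô₁ →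
    [ Ô₁ ] ≈ₚ [ Ô₂ ] → image {Ô₁} (α Ô₁) K₁⊆ ≈ᵏ image {Ô₂} (α Ô₂) K₂⊆ →
    ∀ {x₁ x₂ z} → Extend (Graph (α Ô₁) ⨾ flip (Graph (α Ô₂))) e₁ e₂ x₁ x₂ →
    Graph (extensionMap Ô₁ K₁⊆ e₁ a) x₁ z → Graph (extensionMap Ô₂ K₂⊆ e₂ a) x₂ z
  extensionMap-agree {Ô₁} {Ô₂} {a = a} K₁⊆ K₂⊆ e₁∉ eq eqᵏ new (here refl , refl) =
    here refl , sym (new-cong (α⊆ Ô₁ K₁⊆) (α⊆ Ô₂ K₂⊆) a eq eqᵏ)
  extensionMap-agree K₁⊆ K₂⊆ e₁∉ eq eqᵏ new (there p , _) = ⊥-elim (e₁∉ p)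
  extensionMap-agree K₁⊆ K₂⊆ e₁∉ eq eqᵏ (old (_ , (p , _) , _)) (here refl , _) = ⊥-elim (e₁∉ p)
  extensionMap-agree {Ô₁} {Ô₂} {a = a} K₁⊆ K₂⊆ e₁∉ eq eqᵏ (old (_ , (p , refl) , p₂ , eq₂))
                     (there p₁ , refl) =
    there p₂ , sym (old-cong (α⊆ Ô₁ K₁⊆) (α⊆ Ô₂ K₂⊆) a eq eqᵏ (trans (α-irrelevant Ô₁) (sym eq₂)))

  -- The proof that `K` lies in the poset is extracted from the step, so a transferred step carries
  -- another one; the resulting images of `K` agree only up to `≈ᵏ`.
  extensionMap-irrelevant : ∀ Ô {K} (K⊆ K⊆′ : All ∣ Ô ∣ K) e a →
                            Graph (extensionMap Ô K⊆ e a) ⇒ Graph (extensionMap Ô K⊆′ e a)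
  extensionMap-irrelevant Ô K⊆ K⊆′ e a =
    λ { (here refl , refl) → here refl , new-cong _ _ a ≈ₚ-refl images-≈
      ; (there p , refl)   → there p , old-cong _ _ a ≈ₚ-refl images-≈ refl }
    where
    images-≈ = causes-functional (α-correspondence Ô)
                 (causes-image Ô (α Ô) K⊆′) (causes-image Ô (α Ô) K⊆)

  -- The identity extended by the added event is an isomorphism of the extensions, and `[]-cong`
  -- turns it into an equality of canonical posets.
  δᵃ-cong : ∀ O {K L} a → All ∣ poset O ∣ K → K ≈ᵏ L → δᵃ O K a ≈ₚ δᵃ O L a
  δᵃ-cong (O , _) a K⊆ (K⊆L , L⊆K) =
    []-cong (_ , function-isIsomorphism (extend a _ _ (identity O) record
      { forth = λ z∈ → _ , K⊆L z∈ , (refl , in-O z∈) , refl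
      ; back  = λ z∈ → _ , L⊆K z∈ , (refl , in-O (L⊆K z∈)) , refl
      }))
    where
    in-O : ∀ {z} → z ∈ _ → proj₁ z ∈ X O
    in-O z∈ with lookup K⊆ z∈
    ... | x , refl = proj₂ x

  -- Transporting bisimulations between the two case graphs.

  concreteSim : (∀ O → Rel (PMarking O) (suc 0ℓ)) → Set₁
  concreteSim R = ∀ {O} {P Q : PMarking O} → R O P Q →
    ∀ {K e a O′} {P′ : PMarking O′} → P —[ K ⊢ e ∙ a ]→ P′ →
    Σ[ Q′ ∈ PMarking O′ ] Q —[ K ⊢ e ∙ a ]→ Q′ × R O′ P′ Q′

  abstractSim : (∀ O → Rel (PMarking (poset O)) (suc 0ℓ)) → Set₁
  abstractSim R = ∀ {O} {P Q : PMarking (poset O)} → R O P Q →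
    ∀ {L a O′} {P′ : PMarking (poset O′)} → AbstractStep O O′ P L a P′ →
    Σ[ Q′ ∈ PMarking (poset O′) ] AbstractStep O O′ Q L a Q′ × R O′ P′ Q′

  -- Closure under equality of posets and markings is built in: `corr`, `left` and `right` absorb
  -- it.
  record Image (R : ∀ O → Rel (PMarking O) (suc 0ℓ)) (O : AbstractPoset)
               (P Q : PMarking (poset O)) : Set₁ where
    field
      {Ô}     : LPoset
      {ρ}     : Rel ℰ 0ℓ
      {C D}   : PMarking Ô
      corr    : Correspondence Ô (poset O) ρ
      left    : MarkingRel N ρ (marking C) (marking P)
      right   : MarkingRel N ρ (marking D) (marking Q)
      related : R Ô C D

  record Preimage (R : ∀ O → Rel (PMarking (poset O)) (suc 0ℓ)) (O : LPoset)
                  (P Q : PMarking O) : Set₁ where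
    field
      {Ô}     : AbstractPoset
      {ρ}     : Rel ℰ 0ℓ
      {C D}   : PMarking (poset Ô)
      corr    : Correspondence O (poset Ô) ρ
      left    : MarkingRel N ρ (marking P) (marking C)
      right   : MarkingRel N ρ (marking Q) (marking D)
      related : R Ô C D

  abstractStep :
    ∀ {O O′ : AbstractPoset} {P : PMarking (poset O)} {P′ : PMarking (poset O′)} {L a Ô K e}
      (e∉ : e ∉ X Ô) {C : PMarking Ô} {C′ : PMarking (δ Ô K e a e∉)}
      (step : C —[ K ⊢ e ∙ a ]→ C′) → let K⊆ = _—[_⊢_∙_]→_.K⊆ step in
    poset O ≈ₚ [ Ô ] → CauseRel (Graph (α Ô)) K L →
    poset O′ ≈ₚ δᵃ (abstraction Ô) (image {Ô} (α Ô) K⊆) a →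
    MarkingRel N (Graph (α Ô)) (marking C) (marking P) →
    MarkingRel N (Graph (extensionMap Ô K⊆ e a)) (marking C′) (marking P′) →
    AbstractStep O O′ P L a P′
  abstractStep {Ô = Ô} {e = e} e∉ {C} {C′} step eq k eq′ m m′ = record
    { e∉X          = e∉
    ; step         = step
    ; poset-source = eq
    ; source       = marking-functional N (α-correspondence Ô) m (renameMarking-related N (α Ô) C)
    ; label        = causes-functional (α-correspondence Ô) k (causes-image Ô (α Ô) K⊆)
    ; poset-target = eq′
    ; target       = marking-functional N (extensionMap-correspondence Ô K⊆ _ e∉) m′
                       (renameMarking-related N (extensionMap Ô K⊆ e _) C′)
    }
    where open _—[_⊢_∙_]→_ step using (K⊆)

  module _ {O O′ : AbstractPoset} {P : PMarking (poset O)} {P′ : PMarking (poset O′)} {L a}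
           (st : AbstractStep O O′ P L a P′) where
    open AbstractStep st
    open _—[_⊢_∙_]→_ step using (K⊆)

    source-correspondence : Correspondence Ô (poset O) (Graph (α Ô))
    source-correspondence = respʳ (≈ₚ-sym poset-source) (α-correspondence Ô)

    source-related : MarkingRel N (Graph (α Ô)) (marking C) (marking P)
    source-related = marking-respʳ N (renameMarking-related N (α Ô) C) (≈ᵐ-sym N source)

    label-related : CauseRel (Graph (α Ô)) K L
    label-related = causes-respʳ (causes-image Ô (α Ô) K⊆) (proj₂ label , proj₁ label)

    target-related : MarkingRel N (Graph (extensionMap Ô K⊆ e a)) (marking C′) (marking P′)
    target-related = marking-respʳ N (renameMarking-related N τ C′) (≈ᵐ-sym N target)

  -- The concrete step behind the abstract one is moved to the poset where `R` relates `C₁` and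
  -- `D₁`, answered there, and moved back to `Ô` to induce the abstract answer.
  image-sim : ∀ {R} → concreteSim R → abstractSim (Image R)
  image-sim sim {O} {P} {Q} rel {L} {a} {O′} {P′} st =
    Q′ , abstractStep e∉X step₃ poset-source label~ poset-target′ (marking-flip N Q~D) D′~Q′ , record
      { corr    = compose (inverse E) T
      ; left    = marking-compose N (marking-flip N C′~C₁′)
                    (marking-map N (extensionMap-irrelevant Ô K⊆ K⊆₃ e a) (target-related st))
      ; right   = marking-compose N D₁′~D′ D′~Q′
      ; related = related′
      }
    where
    open Image rel renaming (Ô to Ô₁; C to C₁; D to D₁)
    open AbstractStep st
    open _—[_⊢_∙_]→_ step using (K⊆)
    A = source-correspondence st
    label~ = label-related st
    -- From `Ô` along `α Ô` to the abstract poset, then back along `corr` to `Ô₁`.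
    ψ = compose A (inverse corr)
    choice-K̂ = causes-total ψ K⊆
    K̂ = proj₁ choice-K̂
    K~K̂ = proj₂ choice-K̂
    ê = proj₁ (infinite (X Ô₁))
    ê∉ = proj₂ (infinite (X Ô₁))
    E = extend a e∉X ê∉ ψ K~K̂
    transport-C′ = marking-transport N E C′
    C₁′ = proj₁ transport-C′
    C′~C₁′ = proj₂ transport-C′
    step₁ : C₁ —[ K̂ ⊢ ê ∙ a ]→ C₁′
    step₁ = step-transfer N ψ E old new ê∉ K~K̂ ≈ₚ-refl
              (marking-compose N (source-related st) (marking-flip N left)) C′~C₁′ step
    simulated = sim related step₁
    D₁′ = proj₁ simulated
    step₂ = proj₁ (proj₂ simulated)
    related′ = proj₂ (proj₂ simulated)
    transport-Q = marking-transport N (inverse A) Q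
    D = proj₁ transport-Q
    Q~D = proj₂ transport-Q
    transport-D₁′ = marking-transport N (inverse E) D₁′
    D′ = proj₁ transport-D₁′
    D₁′~D′ = proj₂ transport-D₁′
    -- Pulling back along `ψ` restores the original `K` and `e`, so the induced abstract label is
    -- again `L`.
    step₃ : D —[ K ⊢ e ∙ a ]→ D′
    step₃ = step-transfer N (inverse ψ) (inverse E) (λ r → old r) new e∉X (causes-flip K~K̂) ≈ₚ-refl
              (marking-flip N (marking-compose N (marking-flip N Q~D) (marking-flip N right)))
              D₁′~D′ step₂
    K⊆₃ = _—[_⊢_∙_]→_.K⊆ step₃
    images-≈ = causes-functional (α-correspondence Ô)
                 (causes-image Ô (α Ô) K⊆) (causes-image Ô (α Ô) K⊆₃)
    poset-target′ = ≈ₚ-trans poset-target (δᵃ-cong (abstraction Ô) a (α⊆ Ô K⊆) images-≈)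
    T = respʳ (≈ₚ-sym poset-target′) (extensionMap-correspondence Ô K⊆₃ a e∉X)
    transport-D′ = marking-transport N T D′
    Q′ = proj₁ transport-D′
    D′~Q′ = proj₂ transport-D′

  -- The step of `P` is moved to the abstract poset `B`, made abstract and answered by `R`. The
  -- concrete step behind the answer may live on any poset with canonical form `B`; it is pulled
  -- back to `O`.
  preimage-sim : ∀ {R} → abstractSim R → concreteSim (Preimage R)
  preimage-sim sim {O} {P} {Q} rel {K} {e} {a} {O′} {P′} st =
    Q′ , step₂ , record
      { corr    = compose E₁ T
      ; left    = marking-compose N P′~C₁′ C₁′~P″
      ; right   = marking-map N agree (marking-compose N (marking-flip N D₂′~Q′) (target-related st₂))
      ; related = proj₂ (proj₂ simulated)
      }
    where
    open Preimage rel
    open _—[_⊢_∙_]→_ st using (K⊆; e∉X; poset′)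
    B = poset Ô
    A₁ = respʳ (proj₂ Ô) (α-correspondence B)
    ψ₁ = compose corr (inverse A₁)
    choice-K₁ = causes-total ψ₁ K⊆
    K₁ = proj₁ choice-K₁
    K~K₁ = proj₂ choice-K₁
    e₁ = proj₁ (infinite (X B))
    e₁∉ = proj₂ (infinite (X B))
    E₁ = respˡ (≈ₚ-sym poset′) (extend a e∉X e₁∉ ψ₁ K~K₁)
    -- Although `B` is abstract, `α B` may be a nontrivial automorphism. A concrete marking whose
    -- abstraction is `C` is therefore `C` renamed by its inverse.
    transport-C = marking-transport N (inverse A₁) C
    C₁ = proj₁ transport-C
    transport-P′ = marking-transport N E₁ P′
    C₁′ = proj₁ transport-P′
    P′~C₁′ = proj₂ transport-P′
    step₁ : C₁ —[ K₁ ⊢ e₁ ∙ a ]→ C₁′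
    step₁ = step-transfer N ψ₁ E₁ old new e₁∉ K~K₁ ≈ₚ-refl
              (marking-compose N left (proj₂ transport-C)) P′~C₁′ st
    K₁⊆ = _—[_⊢_∙_]→_.K⊆ step₁
    L = image {B} (α B) K₁⊆
    O″ : AbstractPoset
    O″ = abstraction (δ [ B ] L (proj₁ (infinite (X [ B ]))) a (proj₂ (infinite (X [ B ]))))
    T : Correspondence (δ B K₁ e₁ a e₁∉) (poset O″) (Graph (extensionMap B K₁⊆ e₁ a))
    T = extensionMap-correspondence B K₁⊆ a e₁∉
    transport-C₁′ = marking-transport N T C₁′
    P″ = proj₁ transport-C₁′
    C₁′~P″ = proj₂ transport-C₁′
    st₁ : AbstractStep Ô O″ C L a P″
    st₁ = abstractStep e₁∉ step₁ (≈ₚ-sym (proj₂ Ô)) (causes-image B (α B) K₁⊆) ≈ₚ-refl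
            (marking-flip N (proj₂ transport-C)) C₁′~P″
    simulated = sim related st₁
    st₂ = proj₁ (proj₂ simulated)
    module S₂ = AbstractStep st₂
    K₂⊆ = _—[_⊢_∙_]→_.K⊆ S₂.step
    A₂ = source-correspondence st₂
    ψ₂ = compose corr (inverse A₂)
    -- `K₁` was reached through the inverse of `α B` and `L` is its image under `α B`, so the two
    -- renamings cancel and only `ρ` remains.
    K~L : CauseRel ρ K L
    K~L = causes-map (λ { (y , (k , r , s) , s′) → subst (ρ _) (functional A₁ s s′) r })
            (causes-compose K~K₁ (causes-image B (α B) K₁⊆))
    K~K₂ = causes-compose K~L (causes-flip (label-related st₂))
    E₂ = respˡ (≈ₚ-sym poset′) (extend a e∉X S₂.e∉X ψ₂ K~K₂)
    transport-D₂′ = marking-transport N (inverse E₂) S₂.C′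
    Q′ = proj₁ transport-D₂′
    D₂′~Q′ = proj₂ transport-D₂′
    step₂ : Q —[ K ⊢ e ∙ a ]→ Q′
    step₂ = step-transfer N (inverse ψ₂) (inverse E₂) (λ r → old r) new e∉X (causes-flip K~K₂) poset′
              (marking-flip N (marking-compose N right (marking-flip N (source-related st₂))))
              D₂′~Q′ S₂.step
    agree′ : ∀ {x₂ x₁ z} → Extend (Graph (α S₂.Ô) ⨾ flip (Graph (α B))) S₂.e e₁ x₂ x₁ →
             Graph (extensionMap S₂.Ô K₂⊆ S₂.e a) x₂ z → Graph (extensionMap B K₁⊆ e₁ a) x₁ z
    agree′ = extensionMap-agree K₂⊆ K₁⊆ S₂.e∉X
               (≈ₚ-trans (≈ₚ-sym S₂.poset-source) (≈ₚ-sym (proj₂ Ô)))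
               (proj₂ S₂.label , proj₁ S₂.label)
    -- A single correspondence from `O′` to `O″` must serve both new markings, yet `Q′` arrives
    -- through the answering step. The route through `S₂.Ô` is contained in the route through `B`,
    -- which is enough to convert the relation of markings.
    agree : Extend (ρ ⨾ flip (Graph (α S₂.Ô))) e S₂.e ⨾ Graph (extensionMap S₂.Ô K₂⊆ S₂.e a)
          ⇒ Extend (ρ ⨾ flip (Graph (α B))) e e₁ ⨾ Graph (extensionMap B K₁⊆ e₁ a)
    agree (_ , new , g) = _ , new , agree′ new g
    agree (_ , old (y , r , s₂) , g) =
      let x₁ , s₁ = surjective A₁ (proj₂ (within corr r))
      in x₁ , old (y , r , s₁) , agree′ (old (y , s₂ , s₁)) g

  -- With the converse of `R`, the second half of each bisimulation reduces to the first.
  image-swap : ∀ {R O P Q} → Image R O P Q → Image (λ O → flip (R O)) O Q P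
  image-swap rel = record { corr = corr ; left = right ; right = left ; related = related }
    where open Image rel

  preimage-swap : ∀ {R O P Q} → Preimage R O P Q → Preimage (λ O → flip (R O)) O Q P
  preimage-swap rel = record { corr = corr ; left = right ; right = left ; related = related }
    where open Preimage rel

  image-isBisimulation : ∀ {R} → IsConcreteBisimulation R → IsAbstractBisimulation (Image R)
  image-isBisimulation {R} bis = record
    { resp = λ eq p q rel → let open Image rel in record
        { corr    = respʳ eq corr
        ; left    = marking-respʳ N left p
        ; right   = marking-respʳ N right q
        ; related = related
        }
    ; simˡ = image-sim simˡ
    ; simʳ = λ rel st → let P′ , st′ , rel′ = image-sim simʳ′ (image-swap {R} rel) st
                        in P′ , st′ , image-swap {R′} rel′
    }
    where
    open IsConcreteBisimulation bis
    R′ : ∀ O → Rel (PMarking O) (suc 0ℓ)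
    R′ O = flip (R O)
    simʳ′ : concreteSim R′
    simʳ′ = simʳ

  preimage-isBisimulation : ∀ {R} → IsAbstractBisimulation R → IsConcreteBisimulation (Preimage R)
  preimage-isBisimulation {R} bis = record
    { resp = λ eq p q rel → let open Preimage rel in record
        { corr    = respˡ eq corr
        ; left    = marking-respˡ N p left
        ; right   = marking-respˡ N q right
        ; related = related
        }
    ; simˡ = preimage-sim simˡ
    ; simʳ = λ rel st → let P′ , st′ , rel′ = preimage-sim simʳ′ (preimage-swap {R} rel) st
                        in P′ , st′ , preimage-swap {R′} rel′
    }
    where
    open IsAbstractBisimulation bis
    R′ : ∀ O → Rel (PMarking (poset O)) (suc 0ℓ)
    R′ O = flip (R O)
    simʳ′ : abstractSim R′
    simʳ′ = simʳ

theorem1 : {Act : Set} (ℰ : Set) (infinite : Infinite ℰ) (N : Net Act) →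
    let open CaseGraphs ℰ N in
    (canonical : CanonicalPosets) (choice : Abstract.ExtensionChoice infinite canonical) →
    let open AbstractCaseGraph infinite canonical choice in
    ∀ {O} (c₁ c₂ : PMarking O) →
    c₁ ∼C c₂ ⇔ abstraction O ▷ abstractMarking c₁ ∼AC abstractMarking c₂
theorem1 ℰ infinite N canonical choice {O} c₁ c₂ = mk⇔
  (λ (R , bis , r) → Image infinite N canonical choice R
    , image-isBisimulation infinite N canonical choice bis
    , record { corr = i ; left = renamed c₁ ; right = renamed c₂ ; related = r })
  (λ (R , bis , r) → Preimage infinite N canonical choice R
    , preimage-isBisimulation infinite N canonical choice bis
    , record { corr = i ; left = renamed c₁ ; right = renamed c₂ ; related = r })
  where
  open Posets.CanonicalPosets canonical using (α; α-isIso)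
  i = fromIso (α-isIso O)
  renamed = renameMarking-related N (α O)
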